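{- Let $3\leq n\leq 5$, let $I_n=\{0,\ldots,n-1\}$, and let $\mathrm{U}_n\subseteq\{0,1\}^n$ be the set of binary sequences of length $n$ containing exactly one occurrence of $1$. For $a\in I_n$, let $K_a$ be the simplicial complex over $I_n$ whose maximal simplices are the sets $\{a,b,c\}$ with $b,c$ distinct elements of $I_n\setminus\{a\}$. Then the only minimal complexes generating $\mathrm{U}_n$ are those of the form $K_a$, $a\in I_n$.
   Context: All sets are finite (possibly empty). For $f:B^J\to A^I$ write $f_i(x)=f(x)_i$. For $i\in I$, the input window $\mathcal{W}_f(i)$ is the smallest set $W\subseteq J$ (it exists) such that for all $x,y\in B^J$, $x|_W=y|_W$ implies $f_i(x)=f_i(y)$. A simplicial complex (or complex) over $I$ is a collection of subsets of $I$ (its simplices) closed under taking subsets; the empty set is a simplex of every complex. The communication complex $K_f$ of $f$ is the complex over $I$ in which a non-empty $S\subseteq I$ is a simplex iff $\bigcap_{i\in S}\mathcal{W}_f(i)\neq\emptyset$. A complex $K$ over $I$ generates a language $L\subseteq A^I$ if there exist finite sets $B,J$ and a function $f:B^J\to A^I$ with image exactly $L$ and $K_f\subseteq K$. A complex generating $L$ is minimal if no complex strictly contained in it generates $L$. We write $\{0,1\}^n$ for $\{0,1\}^{I_n}$. -}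

module Defs where

open import Data.Bool.Base using (if_then_else_)
open import Data.Fin.Base using (Fin; zero; suc)
open import Data.Fin.Patterns using (0F; 1F; 2F)
open import Data.Fin.Properties using (all?; any?; _≟_)
open import Data.Fin.Subset
  using (Subset; _∈_; _∉_; _⊆_; ⊤; _∩_; ⋂; _∪_; _-_; ⁅_⁆; Nonempty)
  renaming (⊥ to ∅)
open import Data.Fin.Subset.Properties
  using (_∈?_; _⊆?_; nonempty?; ∈⊤; ∉⊥; x∈p∩q⁺; x∈p∩q⁻; x∈p∪q⁺; x∈p∪q⁻; x∈⁅x⁆;
         x∈⁅y⁆⇒x≡y; x∈p∧x≢y⇒x∈p-y; x∈p⇒p-x⊂p; ⊆-antisym)
open import Data.List.Base using ([]; _∷_; map; allFin)
open import Data.List.Membership.Propositional using () renaming (_∈_ to _∈ˡ_)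
open import Data.List.Membership.Propositional.Properties using (∈-allFin; ∈-map⁺)
open import Data.List.Relation.Unary.Any using (here; there)
open import Data.List.Relation.Unary.All using (All; []; _∷_; universal)
open import Data.List.Relation.Unary.All.Properties using (map⁺)
open import Data.Nat.Base using (ℕ; zero; suc; _+_)
open import Data.Product.Base using (∃; ∃-syntax; _×_; _,_; proj₁; proj₂)
open import Data.Product using (∃!)
open import Data.Sum.Base as Sum using (_⊎_; inj₁; inj₂)
open import Data.Vec.Base using (Vec; []; _∷_; lookup; tabulate)
open import Data.Vec.Properties using (lookup∘tabulate; tabulate∘lookup; tabulate-cong)
open import Function.Base using (_∘_)
open import Function.Bundles using (_⇔_; mk⇔)
open import Level using (0ℓ)
open import Relation.Binary.PropositionalEquality using (_≡_; _≢_; refl; sym; trans; cong; subst)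
open import Relation.Nullary using (¬_; Dec; yes; no; does; contradiction)
open import Relation.Nullary.Decidable using (map′; ¬?; _×-dec_; _→-dec_)
open import Relation.Unary using (Pred; Decidable)
import Relation.Unary as Unary

-- Finite sets are taken to be of the form Fin n, and the set X^Y of functions
-- from Y = Fin n to X is Vec X n, so that equality of functions is _≡_.

private
  variable
    n m b k : ℕ

Language : ℕ → ℕ → Set₁
Language k n = Pred (Vec (Fin k) n) 0ℓ

AgreeOn : Subset m → Vec (Fin b) m → Vec (Fin b) m → Set
AgreeOn W x y = ∀ j → j ∈ W → lookup x j ≡ lookup y j

Determines : (Vec (Fin b) m → Vec (Fin k) n) → Fin n → Subset m → Set
Determines f i W = ∀ x y → AgreeOn W x y → lookup (f x) i ≡ lookup (f y) i

IsInputWindow : (Vec (Fin b) m → Vec (Fin k) n) → Fin n → Subset m → Set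
IsInputWindow f i W = Determines f i W × (∀ W′ → Determines f i W′ → W ⊆ W′)

allVec? : ∀ {P : Pred (Vec (Fin b) m) 0ℓ} → Decidable P → Dec (∀ x → P x)
allVec? {m = zero}  P? = map′ (λ p → λ { [] → p }) (λ h → h []) (P? [])
allVec? {m = suc m} P? =
  map′ (λ h → λ { (a ∷ x) → h a x }) (λ h a x → h (a ∷ x))
       (all? λ a → allVec? λ x → P? (a ∷ x))

module _ (f : Vec (Fin b) m → Vec (Fin k) n) (i : Fin n) where

  determines? : Decidable (Determines f i)
  determines? W = allVec? λ x → allVec? λ y →
    (all? λ j → (j ∈? W) →-dec (lookup x j ≟ lookup y j))
      →-dec (lookup (f x) i ≟ lookup (f y) i)

  determines-⊤ : Determines f i ⊤
  determines-⊤ x y x≈y = cong (λ z → lookup (f z) i)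
    (trans (sym (tabulate∘lookup x))
           (trans (tabulate-cong λ j → x≈y j ∈⊤) (tabulate∘lookup y)))

  determines-⊆ : ∀ {V W} → V ⊆ W → Determines f i V → Determines f i W
  determines-⊆ V⊆W d x y x≈y = d x y (λ j j∈V → x≈y j (V⊆W j∈V))

  determines-∩ : ∀ {V W} → Determines f i V → Determines f i W → Determines f i (V ∩ W)
  determines-∩ {V} {W} dV dW x y x≈y = trans (dV x z x≈z) (dW z y z≈y)
    where
    -- z coincides with x on V and with y elsewhere.
    mix : Fin m → Fin b
    mix j = if does (j ∈? V) then lookup x j else lookup y j

    z : Vec (Fin b) m
    z = tabulate mix

    x≈z : AgreeOn V x z
    x≈z j j∈V = sym (trans (lookup∘tabulate mix j) mix≡x)
      where
      mix≡x : mix j ≡ lookup x j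
      mix≡x with j ∈? V
      ... | yes _  = refl
      ... | no j∉V = contradiction j∈V j∉V

    z≈y : AgreeOn W z y
    z≈y j j∈W = trans (lookup∘tabulate mix j) mix≡y
      where
      mix≡y : mix j ≡ lookup y j
      mix≡y with j ∈? V
      ... | yes j∈V = x≈y j (x∈p∩q⁺ (j∈V , j∈W))
      ... | no _    = refl

  determines-⋂ : ∀ {Ws} → All (Determines f i) Ws → Determines f i (⋂ Ws)
  determines-⋂ []       = determines-⊤
  determines-⋂ (d ∷ ds) = determines-∩ d (determines-⋂ ds)

  inputWindow : ∃ (IsInputWindow f i)
  inputWindow = W , determines-⋂ (map⁺ (universal pruned-determines (allFin m))) , least
    where
    pruned : Fin m → Subset m
    pruned j = if does (determines? (⊤ - j)) then ⊤ - j else ⊤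

    pruned-determines : ∀ j → Determines f i (pruned j)
    pruned-determines j with determines? (⊤ - j)
    ... | yes d = d
    ... | no _  = determines-⊤

    W : Subset m
    W = ⋂ (map pruned (allFin m))

    ⋂⊆ : ∀ {V Ws} → V ∈ˡ Ws → ⋂ Ws ⊆ V
    ⋂⊆ {Ws = V ∷ Ws} (here refl) = proj₁ ∘ x∈p∩q⁻ V (⋂ Ws)
    ⋂⊆ {Ws = V ∷ Ws} (there V∈)  = ⋂⊆ V∈ ∘ proj₂ ∘ x∈p∩q⁻ V (⋂ Ws)

    ∉pruned : ∀ j → Determines f i (⊤ - j) → j ∉ pruned j
    ∉pruned j d j∈ with determines? (⊤ - j)
    ... | yes _ = let (_ , x , x∈ , x∉) = x∈p⇒p-x⊂p {x = j} (∈⊤ {x = j}) in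
                  x∉ (x∈p∧x≢y⇒x∈p-y x∈ λ x≡j → x∉ (subst (_∈ ⊤ - j) (sym x≡j) j∈))
    ... | no ¬d = ¬d d

    least : ∀ W′ → Determines f i W′ → W ⊆ W′
    least W′ d {j} j∈W with j ∈? W′
    ... | yes j∈W′ = j∈W′
    ... | no j∉W′  = contradiction (⋂⊆ (∈-map⁺ pruned (∈-allFin j)) j∈W)
      (∉pruned j (determines-⊆ (λ x∈W′ → x∈p∧x≢y⇒x∈p-y ∈⊤ λ { refl → j∉W′ x∈W′ }) d))

  𝒲 : Subset m
  𝒲 = proj₁ inputWindow

-- The decidability requirement expresses that a complex is a finite
-- set of subsets of Fin n.
record Complex (n : ℕ) : Set₁ where
  field
    Simplex  : Pred (Subset n) 0ℓ
    simplex? : Decidable Simplex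
    empty    : Simplex ∅
    closed   : ∀ {S T} → S ⊆ T → Simplex T → Simplex S

open Complex public

infix 4 _⊆ᶜ_ _⊂ᶜ_ _≐ᶜ_

_⊆ᶜ_ _⊂ᶜ_ _≐ᶜ_ : Complex n → Complex n → Set
K ⊆ᶜ L = Simplex K Unary.⊆ Simplex L
K ⊂ᶜ L = Simplex K Unary.⊂ Simplex L
K ≐ᶜ L = Simplex K Unary.≐ Simplex L

IsMaximalSimplex : Complex n → Subset n → Set
IsMaximalSimplex K S = Simplex K S × (∀ {T} → Simplex K T → S ⊆ T → S ≡ T)

communicationComplex : (Vec (Fin b) m → Vec (Fin k) n) → Complex n
communicationComplex f = record
  { Simplex  = λ S → Nonempty S → ∃[ j ] (∀ i → i ∈ S → j ∈ 𝒲 f i)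
  ; simplex? = λ S → nonempty? S →-dec any? λ j → all? λ i → (i ∈? S) →-dec (j ∈? 𝒲 f i)
  ; empty    = λ (_ , x∈∅) → contradiction x∈∅ ∉⊥
  ; closed   = λ S⊆T h (x , x∈S) →
      let (j , j∈) = h (x , S⊆T x∈S) in j , λ i i∈S → j∈ i (S⊆T i∈S)
  }

Generates : Complex n → Language k n → Set
Generates {n} {k} K L =
  ∃[ b ] ∃[ m ] ∃[ f ]
    (∀ y → L y ⇔ (∃[ x ] f x ≡ y)) ×
    communicationComplex {b} {m} {k} {n} f ⊆ᶜ K

IsMinimalGenerating : Complex n → Language k n → Set₁
IsMinimalGenerating K L = Generates K L × (∀ K′ → K′ ⊂ᶜ K → ¬ Generates K′ L)

U : ∀ n → Language 2 n
U n x = ∃! _≡_ λ i → lookup x i ≡ 1F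

IsTriangleAt : Fin n → Subset n → Set
IsTriangleAt a T =
  ∃[ c ] ∃[ d ] c ≢ a × d ≢ a × c ≢ d × T ≡ ⁅ a ⁆ ∪ ⁅ c ⁆ ∪ ⁅ d ⁆

-- The faces of the triangles containing a. The empty simplex is included
-- separately only because there is no such triangle when n < 3.
K : Fin n → Complex n
K {n} a = record
  { Simplex  = λ S → Nonempty S → ∃[ T ] IsTriangleAt a T × S ⊆ T
  ; simplex? = λ S → nonempty? S →-dec face? S
  ; empty    = λ (_ , x∈∅) → contradiction x∈∅ ∉⊥
  ; closed   = λ S⊆T h (x , x∈S) →
      let (F , tri , T⊆F) = h (x , S⊆T x∈S) in F , tri , λ y∈S → T⊆F (S⊆T y∈S)
  }
  where
  face? : ∀ S → Dec (∃[ T ] IsTriangleAt a T × S ⊆ T)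
  face? S = map′ to from
    (any? λ c → any? λ d → ¬? (c ≟ a) ×-dec ¬? (d ≟ a) ×-dec ¬? (c ≟ d)
      ×-dec (S ⊆? (⁅ a ⁆ ∪ ⁅ c ⁆ ∪ ⁅ d ⁆)))
    where
    Face : Set
    Face = ∃[ c ] ∃[ d ] c ≢ a × d ≢ a × c ≢ d × S ⊆ ⁅ a ⁆ ∪ ⁅ c ⁆ ∪ ⁅ d ⁆

    to : Face → ∃[ T ] IsTriangleAt a T × S ⊆ T
    to (c , d , c≢a , d≢a , c≢d , S⊆) = _ , (c , d , c≢a , d≢a , c≢d , refl) , S⊆

    from : (∃[ T ] IsTriangleAt a T × S ⊆ T) → Face
    from (_ , (c , d , c≢a , d≢a , c≢d , refl) , S⊆) = c , d , c≢a , d≢a , c≢d , S⊆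

K-maximal : (a : Fin (3 + n)) (S : Subset (3 + n)) →
            IsMaximalSimplex (K a) S ⇔ IsTriangleAt a S
K-maximal {n} a S = mk⇔ to from
  where
  triangleAt : ∀ a → ∃ (IsTriangleAt {3 + n} a)
  triangleAt zero          = _ , 1F , 2F , (λ ()) , (λ ()) , (λ ()) , refl
  triangleAt (suc zero)    = _ , 0F , 2F , (λ ()) , (λ ()) , (λ ()) , refl
  triangleAt (suc (suc _)) = _ , 0F , 1F , (λ ()) , (λ ()) , (λ ()) , refl

  to : IsMaximalSimplex (K a) S → IsTriangleAt a S
  to (s , maximal) with nonempty? S
  ... | yes ne with T , tri , S⊆T ← s ne
               with refl ← maximal (λ _ → T , tri , λ p → p) S⊆T = tri
  to (s , maximal) | no ¬ne
    with T , tri ← triangleAt a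
    with refl ← maximal (λ _ → T , tri , λ p → p) (λ x∈S → contradiction (_ , x∈S) ¬ne) = tri

  vertex⁻ : ∀ {x a c d : Fin (3 + n)} → x ∈ ⁅ a ⁆ ∪ ⁅ c ⁆ ∪ ⁅ d ⁆ → x ≡ a ⊎ x ≡ c ⊎ x ≡ d
  vertex⁻ {a = a} {c} {d} =
    Sum.map (x∈⁅y⁆⇒x≡y a) (Sum.map (x∈⁅y⁆⇒x≡y c) (x∈⁅y⁆⇒x≡y d) ∘ x∈p∪q⁻ ⁅ c ⁆ ⁅ d ⁆)
      ∘ x∈p∪q⁻ ⁅ a ⁆ (⁅ c ⁆ ∪ ⁅ d ⁆)

  vertex⁺ : ∀ {x a c d : Fin (3 + n)} → x ≡ a ⊎ x ≡ c ⊎ x ≡ d → x ∈ ⁅ a ⁆ ∪ ⁅ c ⁆ ∪ ⁅ d ⁆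
  vertex⁺ (inj₁ refl)        = x∈p∪q⁺ (inj₁ (x∈⁅x⁆ _))
  vertex⁺ (inj₂ (inj₁ refl)) = x∈p∪q⁺ (inj₂ (x∈p∪q⁺ (inj₁ (x∈⁅x⁆ _))))
  vertex⁺ (inj₂ (inj₂ refl)) = x∈p∪q⁺ (inj₂ (x∈p∪q⁺ (inj₂ (x∈⁅x⁆ _))))

  -- Inclusion between two triangles at a is equality.
  rigid : ∀ {S T} → IsTriangleAt a S → IsTriangleAt a T → S ⊆ T → T ⊆ S
  rigid (c , d , c≢a , d≢a , c≢d , refl) (c′ , d′ , _ , _ , _ , refl) S⊆T x∈T
    with vertex⁻ (S⊆T (vertex⁺ (inj₂ (inj₁ refl)))) | vertex⁻ (S⊆T (vertex⁺ (inj₂ (inj₂ refl))))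
  ... | inj₁ refl        | _                = contradiction refl c≢a
  ... | inj₂ _           | inj₁ refl        = contradiction refl d≢a
  ... | inj₂ (inj₁ refl) | inj₂ (inj₁ refl) = contradiction refl c≢d
  ... | inj₂ (inj₁ refl) | inj₂ (inj₂ refl) = x∈T
  ... | inj₂ (inj₂ refl) | inj₂ (inj₁ refl) = vertex⁺ (Sum.map₂ Sum.swap (vertex⁻ x∈T))
  ... | inj₂ (inj₂ refl) | inj₂ (inj₂ refl) = contradiction refl c≢d

  from : IsTriangleAt a S → IsMaximalSimplex (K a) S
  from tri@(_ , _ , _ , _ , _ , S≡) =
    (λ _ → S , tri , λ p → p) , λ {T} t S⊆T →
      let a∈S = subst (a ∈_) (sym S≡) (vertex⁺ (inj₁ refl))
          (F , tri′ , T⊆F) = t (a , S⊆T a∈S)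
      in ⊆-antisym S⊆T (rigid tri tri′ (T⊆F ∘ S⊆T) ∘ T⊆F)

-- K a generates U: for any two elements other than a, an input read by them and by a
-- lets at most one of the two win their duel; whoever wins all its duels is elected, and
-- a is elected if nobody does.
--
-- Conversely, let f have image U and call a triangle missing if no input is read by its
-- three vertices. If i wins at x and j ≠ i wins at y, then x and y differ on some input
-- read by both i and j, since otherwise both would win at a common input. Evaluating f at
-- hybrids of inputs at which known elements win gives two obstructions: the triangles
-- through an edge are not all missing, and for n = 5 two triangles with exactly one
-- vertex in common are not both missing. But if every K a had a missing triangle, the
-- missing triangles would cover all the vertices, and for n ≤ 5 one of these two
-- configurations would occur.

module Submission where

open import Defs
open import Data.Bool.Base using (true; false; if_then_else_)
open import Data.Empty using (⊥; ⊥-elim)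
open import Data.Fin.Base using (Fin; zero; suc; combine; remQuot)
open import Data.Fin.Patterns using (0F; 1F; 2F)
open import Data.Fin.Properties using (all?; any?; _≟_; combine-injective; combine-remQuot)
open import Data.Fin.Subset using (Subset; _∈_; _∉_; _⊆_; ⊤; ∣_∣; _∪_; _∩_; _-_; ⁅_⁆)
open import Data.Fin.Subset.Properties
  using (_∈?_; _⊆?_; nonempty?; ∈⊤; x∈p∪q⁺; x∈p∪q⁻; x∈⁅x⁆; x∈⁅y⁆⇒x≡y; x∈p∧x≢y⇒x∈p-y; x∈p⇒p-x⊂p)
open import Data.Nat.Base using (ℕ; zero; suc; _+_; _*_; _≤_; s≤s)
import Data.Nat.Properties as ℕ
open import Data.Product.Base using (∃-syntax; _×_; _,_; proj₁; proj₂)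
open import Data.Sum.Base as Sum using (_⊎_; inj₁; inj₂; [_,_]′)
open import Data.Unit.Base using (tt)
open import Data.Vec.Base using (Vec; []; _∷_; lookup; replicate; tabulate; _[_]≔_)
open import Data.Vec.Properties
  using (lookup∘tabulate; lookup∘update; lookup∘update′; lookup-replicate)
open import Data.Vec.Relation.Binary.Pointwise.Extensional using (ext; Pointwise-≡⇒≡)
open import Function.Base using (_∘_)
open import Function.Bundles using (_⇔_; mk⇔; module Equivalence)
open import Level using (0ℓ)
open import Relation.Binary.PropositionalEquality
  using (_≡_; _≢_; refl; sym; trans; cong; cong₂; subst)
open import Relation.Nullary using (¬_; Dec; yes; no; does; contradiction)
open import Relation.Nullary.Decidable
  using (map′; ¬?; _×-dec_; _⊎-dec_; _→-dec_; does-⇔; decidable-stable; toWitness)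
open import Relation.Unary using (Pred; Decidable)

open Equivalence using (to; from)

private
  variable
    n m b k : ℕ

-- Triangles, one-hot vectors and input windows.

triangle : (a b c : Fin n) → Subset n
triangle a b c = ⁅ a ⁆ ∪ ⁅ b ⁆ ∪ ⁅ c ⁆

∈-triangle⁺ : ∀ {x a b c : Fin n} → x ≡ a ⊎ x ≡ b ⊎ x ≡ c → x ∈ triangle a b c
∈-triangle⁺ (inj₁ refl)        = x∈p∪q⁺ (inj₁ (x∈⁅x⁆ _))
∈-triangle⁺ (inj₂ (inj₁ refl)) = x∈p∪q⁺ (inj₂ (x∈p∪q⁺ (inj₁ (x∈⁅x⁆ _))))
∈-triangle⁺ (inj₂ (inj₂ refl)) = x∈p∪q⁺ (inj₂ (x∈p∪q⁺ (inj₂ (x∈⁅x⁆ _))))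

∈-triangle⁻ : ∀ {x a b c : Fin n} → x ∈ triangle a b c → x ≡ a ⊎ x ≡ b ⊎ x ≡ c
∈-triangle⁻ {a = a} {b} {c} x∈ with x∈p∪q⁻ ⁅ a ⁆ (⁅ b ⁆ ∪ ⁅ c ⁆) x∈
... | inj₁ x∈a = inj₁ (x∈⁅y⁆⇒x≡y a x∈a)
... | inj₂ x∈′ with x∈p∪q⁻ ⁅ b ⁆ ⁅ c ⁆ x∈′
...   | inj₁ x∈b = inj₂ (inj₁ (x∈⁅y⁆⇒x≡y b x∈b))
...   | inj₂ x∈c = inj₂ (inj₂ (x∈⁅y⁆⇒x≡y c x∈c))

oneHot : Fin n → Vec (Fin 2) n
oneHot {n} i = replicate n 0F [ i ]≔ 1F

oneHot-U : (i : Fin n) → U n (oneHot i)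
oneHot-U {n} i = i , lookup∘update i (replicate n 0F) 1F , hot
  where
  hot : ∀ {j} → lookup (oneHot i) j ≡ 1F → i ≡ j
  hot {j} eq with i ≟ j
  ... | yes i≡j = i≡j
  ... | no i≢j
    with () ← trans (sym (trans (lookup∘update′ (i≢j ∘ sym) (replicate n 0F) 1F)
                                (lookup-replicate j 0F))) eq

third : (a b : Fin (3 + n)) → ∃[ c ] a ≢ c × b ≢ c
third zero          zero          = 1F , (λ ()) , (λ ())
third zero          (suc zero)    = 2F , (λ ()) , (λ ())
third zero          (suc (suc _)) = 1F , (λ ()) , (λ ())
third (suc zero)    zero          = 2F , (λ ()) , (λ ())
third (suc zero)    (suc _)       = 0F , (λ ()) , (λ ())
third (suc (suc _)) zero          = 1F , (λ ()) , (λ ())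
third (suc (suc _)) (suc _)       = 0F , (λ ()) , (λ ())

𝒲-excludes : (f : Vec (Fin b) m → Vec (Fin k) n) (i : Fin n) {j : Fin m} →
             Determines f i (⊤ - j) → j ∉ 𝒲 f i
𝒲-excludes f i {j} d j∈ = x∉p-x (proj₂ (proj₂ (inputWindow f i)) (⊤ - j) d j∈)
  where
  x∉p-x : j ∉ ⊤ - j
  x∉p-x j∈⊤-j with _ , x , x∈ , x∉ ← x∈p⇒p-x⊂p {x = j} (∈⊤ {x = j}) =
    x∉ (x∈p∧x≢y⇒x∈p-y x∈ λ x≡j → x∉ (subst (_∈ ⊤ - j) (sym x≡j) j∈⊤-j))

binary-ext : {y z : Vec (Fin 2) n} →
             (∀ i → lookup y i ≡ 1F ⇔ lookup z i ≡ 1F) → y ≡ z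
binary-ext {y = y} {z} y⇔z = Pointwise-≡⇒≡ (ext eq)
  where
  eq : ∀ i → lookup y i ≡ lookup z i
  eq i with lookup y i | lookup z i | y⇔z i
  ... | 0F | 0F | _   = refl
  ... | 1F | 1F | _   = refl
  ... | 0F | 1F | y⇔z with () ← from y⇔z refl
  ... | 1F | 0F | y⇔z with () ← to y⇔z refl

bit : {A : Set} → Dec A → Fin 2
bit A? = if does A? then 1F else 0F

bit-1F : {A : Set} (A? : Dec A) → bit A? ≡ 1F ⇔ A
bit-1F (yes a) = mk⇔ (λ _ → a) (λ _ → refl)
bit-1F (no ¬a) = mk⇔ (λ ()) (λ a → contradiction a ¬a)

-- Generating `U n` by duels.

-- The inputs are indexed by the ordered pairs (i , c), and i wins its duel with c if the
-- inputs at (i , c) and (c , i) both name i.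
module Duels {n} (a : Fin n) (third : ∀ k → ∃[ c ] a ≢ c × k ≢ c) where

  Input : Set
  Input = Vec (Fin n) (n * n)

  Champion : Input → Fin n → Set
  Champion x i = a ≢ i × (∀ c → a ≢ c → i ≢ c →
    lookup x (combine i c) ≡ i × lookup x (combine c i) ≡ i)

  champion? : ∀ x i → Dec (Champion x i)
  champion? x i = ¬? (a ≟ i) ×-dec all? λ c → ¬? (a ≟ c) →-dec ¬? (i ≟ c) →-dec
    (lookup x (combine i c) ≟ i) ×-dec (lookup x (combine c i) ≟ i)

  Elected : Input → Fin n → Set
  Elected x i = Champion x i ⊎ a ≡ i × ¬ (∃[ k ] Champion x k)

  elected? : ∀ x i → Dec (Elected x i)
  elected? x i = champion? x i ⊎-dec ((a ≟ i) ×-dec ¬? (any? (champion? x)))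

  f : Input → Vec (Fin 2) n
  f x = tabulate λ i → bit (elected? x i)

  lookup-f : ∀ x i → lookup (f x) i ≡ 1F ⇔ Elected x i
  lookup-f x i = mk⇔
    (λ eq → to (bit-1F (elected? x i)) (trans (sym (lookup∘tabulate _ i)) eq))
    (λ e → trans (lookup∘tabulate _ i) (from (bit-1F (elected? x i)) e))

  -- Two distinct champions would both have to be named by the input at `(i , j)`.
  champion-unique : ∀ x {i j} → Champion x i → Champion x j → i ≡ j
  champion-unique x {i} {j} (a≢i , i-wins) (a≢j , j-wins) with i ≟ j
  ... | yes i≡j = i≡j
  ... | no i≢j  = trans (sym (proj₁ (i-wins j a≢j i≢j))) (proj₂ (j-wins i a≢i (i≢j ∘ sym)))

  elected-unique : ∀ x {i j} → Elected x i → Elected x j → i ≡ j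
  elected-unique x (inj₁ ci)         (inj₁ cj)         = champion-unique x ci cj
  elected-unique x (inj₁ ci)         (inj₂ (_ , none)) = contradiction (_ , ci) none
  elected-unique x (inj₂ (_ , none)) (inj₁ cj)         = contradiction (_ , cj) none
  elected-unique x (inj₂ (refl , _)) (inj₂ (refl , _)) = refl

  elected : ∀ x → ∃[ i ] Elected x i
  elected x with any? (champion? x)
  ... | yes (i , ci) = i , inj₁ ci
  ... | no none      = a , inj₂ (refl , none)

  unanimous : ∀ i → Elected (replicate (n * n) i) i
  unanimous i with a ≟ i
  ... | no a≢i = inj₁ (a≢i , λ c _ _ →
    lookup-replicate (combine i c) i , lookup-replicate (combine c i) i)
  -- A champion `k` needs an opponent `c` besides `a`, and the input of their duel names `a`, not
  -- `k`.
  ... | yes refl = inj₂ (refl , λ { (k , a≢k , k-wins) →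
    let (c , a≢c , k≢c) = third k in
    a≢k (trans (sym (lookup-replicate (combine k c) a)) (proj₁ (k-wins c a≢c k≢c))) })

  image : ∀ y → U n y ⇔ (∃[ x ] f x ≡ y)
  image y = mk⇔ reached exactly-one
    where
    reached : U n y → ∃[ x ] f x ≡ y
    reached (i , yi , only) = x , binary-ext λ j → mk⇔
      (λ e → subst (λ j → lookup y j ≡ 1F)
               (elected-unique x (unanimous i) (to (lookup-f x j) e)) yi)
      (λ yj → from (lookup-f x j) (subst (Elected x) (only yj) (unanimous i)))
      where
      x : Input
      x = replicate (n * n) i

    exactly-one : ∃[ x ] f x ≡ y → U n y
    exactly-one (x , refl) with i , e ← elected x =
      i , from (lookup-f x i) e , λ {j} e′ → elected-unique x e (to (lookup-f x j) e′)

  -- An upper bound for the windows, chosen so that the readers of one input lie on a triangle at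
  -- `a`; nobody reads a degenerate pair.
  Reads : Fin n → Fin n → Fin n → Set
  Reads i c d = c ≢ a × d ≢ a × c ≢ d × (i ≡ a ⊎ i ≡ c ⊎ i ≡ d)

  reads? : ∀ i c d → Dec (Reads i c d)
  reads? i c d = ¬? (c ≟ a) ×-dec ¬? (d ≟ a) ×-dec ¬? (c ≟ d)
    ×-dec ((i ≟ a) ⊎-dec (i ≟ c) ⊎-dec (i ≟ d))

  champion-local : ∀ x y {c d i} → ¬ Reads i c d → AgreeOn (⊤ - combine c d) x y →
                   Champion x i → Champion y i
  champion-local x y {c} {d} {i} ¬reads x≈y (a≢i , i-wins) =
    a≢i , λ e a≢e i≢e → let (ie , ei) = i-wins e a≢e i≢e in
      trans (sym (x≈y _ (other λ { refl →
        ¬reads (a≢i ∘ sym , a≢e ∘ sym , i≢e , inj₂ (inj₁ refl)) }))) ie ,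
      trans (sym (x≈y _ (other λ { refl →
        ¬reads (a≢e ∘ sym , a≢i ∘ sym , i≢e ∘ sym , inj₂ (inj₂ refl)) }))) ei
    where
    other : ∀ {p q} → ¬ ((p , q) ≡ (c , d)) → combine p q ∈ ⊤ - combine c d
    other {p} {q} pq≢cd = x∈p∧x≢y⇒x∈p-y ∈⊤ λ eq →
      let (p≡c , q≡d) = combine-injective p q c d eq in pq≢cd (cong₂ _,_ p≡c q≡d)

  elected-local : ∀ x y {c d i} → ¬ Reads i c d → AgreeOn (⊤ - combine c d) x y →
                  Elected x i → Elected y i
  elected-local x y ¬reads x≈y (inj₁ ci) = inj₁ (champion-local x y ¬reads x≈y ci)
  -- The vertex `a` reads every genuine pair, so a pair that it ignores is degenerate and no
  -- candidate `k` reads it either.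
  elected-local x y ¬reads x≈y (inj₂ (refl , none)) = inj₂ (refl , λ (k , ck) →
    none (k , champion-local y x
      (λ { (c≢a , d≢a , c≢d , _) → ¬reads (c≢a , d≢a , c≢d , inj₁ refl) })
      (λ j j∈ → sym (x≈y j j∈)) ck))

  window-reads : ∀ {i} c d → combine c d ∈ 𝒲 f i → Reads i c d
  window-reads {i} c d cd∈ = decidable-stable (reads? i c d) λ ¬reads →
    𝒲-excludes f i (λ x y x≈y → trans (lookup∘tabulate _ i) (trans
      (cong (if_then 1F else 0F) (does-⇔
        (mk⇔ (elected-local x y ¬reads x≈y)
             (elected-local y x ¬reads (λ j j∈ → sym (x≈y j j∈))))
        (elected? x i) (elected? y i)))
      (sym (lookup∘tabulate _ i)))) cd∈

  K-generates : Generates (K a) (U n)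
  K-generates = n , n * n , f , image , λ {S} simplex ne@(i₀ , i₀∈S) →
    let (j , j∈) = simplex ne
        (c , d)  = remQuot n j
        reads i i∈S = window-reads {i} c d
          (subst (_∈ 𝒲 f i) (sym (combine-remQuot {n} n j)) (j∈ i i∈S))
        (c≢a , d≢a , c≢d , _) = reads i₀ i₀∈S
    in triangle a c d , (c , d , c≢a , d≢a , c≢d , refl) ,
       λ {i} i∈S → ∈-triangle⁺ (proj₂ (proj₂ (proj₂ (reads i i∈S))))

pigeonhole : ∀ {p q x y z : Fin n} → x ≡ p ⊎ x ≡ q → y ≡ p ⊎ y ≡ q → z ≡ p ⊎ z ≡ q →
             x ≡ y ⊎ x ≡ z ⊎ y ≡ z
pigeonhole (inj₁ refl) (inj₁ refl) _           = inj₁ refl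
pigeonhole (inj₂ refl) (inj₂ refl) _           = inj₁ refl
pigeonhole (inj₁ refl) (inj₂ refl) (inj₁ refl) = inj₂ (inj₁ refl)
pigeonhole (inj₁ refl) (inj₂ refl) (inj₂ refl) = inj₂ (inj₂ refl)
pigeonhole (inj₂ refl) (inj₁ refl) (inj₁ refl) = inj₂ (inj₂ refl)
pigeonhole (inj₂ refl) (inj₁ refl) (inj₂ refl) = inj₂ (inj₁ refl)

-- Obstructions from hybrid inputs.

module Election
  (f : Vec (Fin b) m → Vec (Fin 2) n)
  (image : ∀ y → U n y ⇔ (∃[ x ] f x ≡ y))
  (W : Fin n → Subset m) (W-determines : ∀ i → Determines f i (W i))
  where

  Input : Set
  Input = Vec (Fin b) m

  Wins : Fin n → Input → Set
  Wins i x = lookup (f x) i ≡ 1F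

  winner : ∀ x → ∃[ i ] Wins i x
  winner x = let (i , wins , _) = from (image (f x)) (x , refl) in i , wins

  unique : ∀ {i j} x → Wins i x → Wins j x → i ≡ j
  unique x wi wj = let (_ , _ , only) = from (image (f x)) (x , refl) in
    trans (sym (only wi)) (only wj)

  elect : ∀ i → ∃[ x ] Wins i x
  elect i with x , fx≡ ← to (image (oneHot i)) (oneHot-U i) =
    x , trans (cong (λ y → lookup y i) fx≡) (lookup∘update i (replicate n 0F) 1F)

  local : ∀ {i x y} → AgreeOn (W i) x y → Wins i x → Wins i y
  local {i} {x} {y} x≈y wins = trans (sym (W-determines i x y x≈y)) wins

  -- Hybrids are given by the source copied at each position, so that agreement reduces to equality
  -- of sources.
  splice : (Fin m → Input) → Input
  splice s = tabulate λ k → lookup (s k) k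

  lookup-splice : ∀ s {k x} → s k ≡ x → lookup (splice s) k ≡ lookup x k
  lookup-splice s {k} sk≡x = trans (lookup∘tabulate _ k) (cong (λ y → lookup y k) sk≡x)

  -- Otherwise the hybrid taking `x` on `W i` and `y` off it would elect both.
  clash : ∀ {i j x y} → i ≢ j → Wins i x → Wins j y →
          ¬ (∀ k → k ∈ W i → k ∈ W j → lookup x k ≡ lookup y k)
  clash {i} {j} {x} {y} i≢j wi wj x≈y =
    i≢j (unique (splice s) (local x≈z wi) (local y≈z wj))
    where
    s : Fin m → Input
    s k = if does (k ∈? W i) then x else y

    x≈z : AgreeOn (W i) x (splice s)
    x≈z k k∈i = sym (lookup-splice s sk≡x)
      where
      sk≡x : s k ≡ x
      sk≡x with k ∈? W i
      ... | yes _  = refl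
      ... | no k∉i = contradiction k∈i k∉i

    y≈z : AgreeOn (W j) y (splice s)
    y≈z k k∈j = sym (trans (lookup∘tabulate _ k) sk≈y)
      where
      sk≈y : lookup (s k) k ≡ lookup y k
      sk≈y with k ∈? W i
      ... | yes k∈i = x≈y k k∈i k∈j
      ... | no _    = refl

  Apart : (u v w : Fin n) → Set
  Apart u v w = ∀ k → k ∈ W u → k ∈ W v → ¬ k ∈ W w

  -- A hybrid of three inputs at which u loses to t, v loses to u, and everyone
  -- else loses to v.
  edge-in-triangle : ∀ {u v t} → u ≢ v → u ≢ t → v ≢ t →
                     ¬ (∀ w → u ≢ w → v ≢ w → Apart u v w)
  edge-in-triangle {u} {v} {t} u≢v u≢t v≢t apart
    with xᵤ , wᵤ ← elect u | xᵥ , wᵥ ← elect v | xₜ , wₜ ← elect t = loser (winner z)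
    where
    -- Inputs read by both `u` and `v` are read by nobody else. Hence `u` and `t` share only
    -- positions filled from `xₜ`, and `v` shares with a third vertex only positions filled from
    -- `xᵥ`.
    s : Fin m → Input
    s k with k ∈? W u | k ∈? W v
    ... | yes _ | yes _ = xᵤ
    ... | yes _ | no  _ = xₜ
    ... | no  _ | _     = xᵥ

    z : Input
    z = splice s

    loser : ¬ (∃[ i ] Wins i z)
    loser (i , wins) with i ≟ u | i ≟ v
    ... | yes refl | _ = clash u≢t wins wₜ λ k k∈u k∈t → lookup-splice s (eq k k∈u k∈t)
      where
      eq : ∀ k → k ∈ W u → k ∈ W t → s k ≡ xₜ
      eq k k∈u k∈t with k ∈? W u | k ∈? W v
      ... | yes _  | yes k∈v = contradiction k∈t (apart t u≢t v≢t k k∈u k∈v)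
      ... | yes _  | no  _   = refl
      ... | no k∉u | _       = contradiction k∈u k∉u
    ... | no _ | yes refl = clash (u≢v ∘ sym) wins wᵤ λ k k∈v k∈u → lookup-splice s (eq k k∈v k∈u)
      where
      eq : ∀ k → k ∈ W v → k ∈ W u → s k ≡ xᵤ
      eq k k∈v k∈u with k ∈? W u | k ∈? W v
      ... | yes _  | yes _  = refl
      ... | yes _  | no k∉v = contradiction k∈v k∉v
      ... | no k∉u | _      = contradiction k∈u k∉u
    ... | no i≢u | no i≢v = clash i≢v wins wᵥ λ k k∈i k∈v → lookup-splice s (eq k k∈i k∈v)
      where
      eq : ∀ k → k ∈ W i → k ∈ W v → s k ≡ xᵥ
      eq k k∈i k∈v with k ∈? W u | k ∈? W v
      ... | yes k∈u | yes _  = contradiction k∈i (apart i (i≢u ∘ sym) (i≢v ∘ sym) k k∈u k∈v)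
      ... | yes _   | no k∉v = contradiction k∈v k∉v
      ... | no _    | _      = refl

  -- If `Apart u i j`, all inputs common to `i` and `j` lie off `W u`, so the values there already
  -- rule one of the two out. Silence records such an exclusion.
  record Silent (u i : Fin n) (x : Input) : Set where
    constructor silenced
    field
      loses : ∀ z → (∀ k → k ∉ W u → lookup z k ≡ lookup x k) → ¬ Wins i z

  silent : ∀ {u i j x} → i ≢ j → Apart u i j → Wins i x → Silent u j x
  silent i≢j apart wi = silenced λ z z≈x wj →
    clash i≢j wi wj λ k k∈i k∈j → sym (z≈x k λ k∈u → apart k k∈u k∈i k∈j)

  -- If both could still win, two such wins would clash, since they agree off `W u`. The negative
  -- form serves as a case split when refuting.
  one-silent : ∀ {u i j x} → i ≢ j → Apart u i j → ¬ Silent u i x → ¬ ¬ Silent u j x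
  one-silent i≢j apart ¬si ¬sj =
    ¬si (silenced λ z z≈x wi → ¬sj (silenced λ z′ z′≈x wj → clash i≢j wi wj λ k k∈i k∈j →
      let k∉u = λ k∈u → apart k k∈u k∈i k∈j in trans (z≈x k k∉u) (sym (z′≈x k k∉u))))

  -- The inputs read by u fall into four classes, each read by at most one of v, v′ and
  -- at most one of w, w′. The argument p of a hybrid is used at the inputs not read by u.
  module Classes {u v v′ w w′ : Fin n}
    (exhaustive : ∀ i → i ≡ u ⊎ i ≡ v ⊎ i ≡ v′ ⊎ i ≡ w ⊎ i ≡ w′)
    (u≢v : u ≢ v) (u≢w : u ≢ w) (v≢w : v ≢ w)
    (apart-v : Apart u v v′) (apart-w : Apart u w w′)
    where

    -- Besides `u`, the class filled from `a` has at most the readers `v` and `w`, that of `b` has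
    -- `v` and `w′`, that of `c` has `v′` and `w`, and that of `d` has `v′` and `w′`.
    select : (p a b c d : Input) → Fin m → Input
    select p a b c d k with k ∈? W u | k ∈? W v | k ∈? W w
    ... | no  _ | _     | _     = p
    ... | yes _ | yes _ | yes _ = a
    ... | yes _ | yes _ | no  _ = b
    ... | yes _ | no  _ | yes _ = c
    ... | yes _ | no  _ | no  _ = d

    hybrid : (p a b c d : Input) → Input
    hybrid p a b c d = splice (select p a b c d)

    transfer : ∀ {i p a b c d p′ a′ b′ c′ d′} →
               (∀ k → k ∈ W i → select p a b c d k ≡ select p′ a′ b′ c′ d′ k) →
               Wins i (hybrid p a b c d) → Wins i (hybrid p′ a′ b′ c′ d′)
    transfer eq = local λ k k∈i →
      trans (lookup-splice (select _ _ _ _ _) (eq k k∈i)) (sym (lookup∘tabulate _ k))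

    local-u : ∀ {p p′ a b c d} → Wins u (hybrid p a b c d) → Wins u (hybrid p′ a b c d)
    local-u {p} {p′} {a} {b} {c} {d} = transfer eq
      where
      eq : ∀ k → k ∈ W u → select p a b c d k ≡ select p′ a b c d k
      eq k k∈u with k ∈? W u | k ∈? W v | k ∈? W w
      ... | no k∉u | _     | _     = contradiction k∈u k∉u
      ... | yes _  | yes _ | yes _ = refl
      ... | yes _  | yes _ | no  _ = refl
      ... | yes _  | no  _ | yes _ = refl
      ... | yes _  | no  _ | no  _ = refl

    local-v : ∀ {p a b c c′ d d′} → Wins v (hybrid p a b c d) → Wins v (hybrid p a b c′ d′)
    local-v {p} {a} {b} {c} {c′} {d} {d′} = transfer eq
      where
      eq : ∀ k → k ∈ W v → select p a b c d k ≡ select p a b c′ d′ k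
      eq k k∈v with k ∈? W u | k ∈? W v | k ∈? W w
      ... | no  _ | _      | _     = refl
      ... | yes _ | yes _  | yes _ = refl
      ... | yes _ | yes _  | no  _ = refl
      ... | yes _ | no k∉v | _     = contradiction k∈v k∉v

    local-v′ : ∀ {p a a′ b b′ c d} → Wins v′ (hybrid p a b c d) → Wins v′ (hybrid p a′ b′ c d)
    local-v′ {p} {a} {a′} {b} {b′} {c} {d} = transfer eq
      where
      eq : ∀ k → k ∈ W v′ → select p a b c d k ≡ select p a′ b′ c d k
      eq k k∈v′ with k ∈? W u | k ∈? W v | k ∈? W w
      ... | no  _   | _       | _     = refl
      ... | yes k∈u | yes k∈v | _     = contradiction k∈v′ (apart-v k k∈u k∈v)
      ... | yes _   | no  _   | yes _ = refl
      ... | yes _   | no  _   | no  _ = refl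

    local-w : ∀ {p a b b′ c d d′} → Wins w (hybrid p a b c d) → Wins w (hybrid p a b′ c d′)
    local-w {p} {a} {b} {b′} {c} {d} {d′} = transfer eq
      where
      eq : ∀ k → k ∈ W w → select p a b c d k ≡ select p a b′ c d′ k
      eq k k∈w with k ∈? W u | k ∈? W v | k ∈? W w
      ... | no  _ | _     | _      = refl
      ... | yes _ | yes _ | yes _  = refl
      ... | yes _ | no  _ | yes _  = refl
      ... | yes _ | yes _ | no k∉w = contradiction k∈w k∉w
      ... | yes _ | no  _ | no k∉w = contradiction k∈w k∉w

    local-w′ : ∀ {p a a′ b c c′ d} → Wins w′ (hybrid p a b c d) → Wins w′ (hybrid p a′ b c′ d)
    local-w′ {p} {a} {a′} {b} {c} {c′} {d} = transfer eq
      where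
      eq : ∀ k → k ∈ W w′ → select p a b c d k ≡ select p a′ b c′ d k
      eq k k∈w′ with k ∈? W u | k ∈? W v | k ∈? W w
      ... | no  _   | _     | _       = refl
      ... | yes k∈u | yes _ | yes k∈w = contradiction k∈w′ (apart-w k k∈u k∈w)
      ... | yes k∈u | no  _ | yes k∈w = contradiction k∈w′ (apart-w k k∈u k∈w)
      ... | yes _   | yes _ | no  _   = refl
      ... | yes _   | no  _ | no  _   = refl

    uniform : ∀ {i x} → Wins i x → Wins i (hybrid x x x x x)
    uniform {i} {x} = local λ k _ → sym (lookup-splice (select x x x x x) (eq k))
      where
      eq : ∀ k → select x x x x x k ≡ x
      eq k with k ∈? W u | k ∈? W v | k ∈? W w
      ... | no  _ | _     | _     = refl
      ... | yes _ | yes _ | yes _ = refl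
      ... | yes _ | yes _ | no  _ = refl
      ... | yes _ | no  _ | yes _ = refl
      ... | yes _ | no  _ | no  _ = refl

    silence : ∀ {i p} → Silent u i p → ∀ {a b c d} → ¬ Wins i (hybrid p a b c d)
    silence {i} {p} quiet {a} {b} {c} {d} =
      Silent.loses quiet _ λ k k∉u → lookup-splice (select p a b c d) (eq k k∉u)
      where
      eq : ∀ k → k ∉ W u → select p a b c d k ≡ p
      eq k k∉u with k ∈? W u | k ∈? W v | k ∈? W w
      ... | no  _   | _ | _ = refl
      ... | yes k∈u | _ | _ = contradiction k∈u k∉u

    -- The silences make winning for u insensitive to the classes a and d, so that it is
    -- decided by b and c alone: u wins at (x , x) but loses at (y , x) and (x , z). Off
    -- W u the input is now p, where only u, v and w can win. Hence v wins when b is y,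
    -- whatever c is, and w wins when c is z, whatever b is.
    opposite-silences : ∀ {p q} → Silent u v′ p → Silent u w′ p →
                        Silent u v q → Silent u w q → ⊥
    opposite-silences {p} {q} v′-silent w′-silent v-silent w-silent
      with x , u-wins ← elect u | y , v-wins ← elect v | z , w-wins ← elect w =
      v≢w (unique (hybrid p x y z x) v-wins-at w-wins-at)
      where
      -- Over `p` the only rivals of `u` are `v` and `w`, and neither sees the class `d`.
      free-d : ∀ {a b c d d′} → Wins u (hybrid p a b c d) → Wins u (hybrid p a b c d′)
      free-d {a} {b} {c} {d} {d′} wins with winner (hybrid p a b c d′)
      ... | i , wins′ with exhaustive i
      ... | inj₁ refl                      = wins′
      ... | inj₂ (inj₁ refl)               = contradiction (unique _ wins (local-v wins′)) u≢v
      ... | inj₂ (inj₂ (inj₁ refl))        = contradiction wins′ (silence v′-silent)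
      ... | inj₂ (inj₂ (inj₂ (inj₁ refl))) = contradiction (unique _ wins (local-w wins′)) u≢w
      ... | inj₂ (inj₂ (inj₂ (inj₂ refl))) = contradiction wins′ (silence w′-silent)

      -- Since `u` reads nothing off `W u`, its win at `x` persists over `p`, where `v′` cannot win.
      u≢v′ : u ≢ v′
      u≢v′ refl = silence v′-silent {x} {x} {x} {x} (local-u (uniform u-wins))

      u≢w′ : u ≢ w′
      u≢w′ refl = silence w′-silent {x} {x} {x} {x} (local-u (uniform u-wins))

      -- Over `q` the rivals are `v′` and `w′`, and neither sees the class `a`.
      free-a : ∀ {a a′ b c d} → Wins u (hybrid q a b c d) → Wins u (hybrid q a′ b c d)
      free-a {a} {a′} {b} {c} {d} wins with winner (hybrid q a′ b c d)
      ... | i , wins′ with exhaustive i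
      ... | inj₁ refl                      = wins′
      ... | inj₂ (inj₁ refl)               = contradiction wins′ (silence v-silent)
      ... | inj₂ (inj₂ (inj₁ refl))        = contradiction (unique _ wins (local-v′ wins′)) u≢v′
      ... | inj₂ (inj₂ (inj₂ (inj₁ refl))) = contradiction wins′ (silence w-silent)
      ... | inj₂ (inj₂ (inj₂ (inj₂ refl))) = contradiction (unique _ wins (local-w′ wins′)) u≢w′

      free : ∀ {r r′ a a′ b c d d′} → Wins u (hybrid r a b c d) → Wins u (hybrid r′ a′ b c d′)
      free = local-u ∘ free-d ∘ local-u ∘ free-a ∘ local-u

      u-wins-at : ∀ {r a d} → Wins u (hybrid r a x x d)
      u-wins-at = free (uniform u-wins)

      u-loses-y : ∀ {r a d} → ¬ Wins u (hybrid r a y x d)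
      -- The free places are filled so that `v` sees only `y`.
      u-loses-y wins = u≢v (unique (hybrid y y y x x) (free wins) (local-v (uniform v-wins)))

      u-loses-z : ∀ {r a d} → ¬ Wins u (hybrid r a x z d)
      u-loses-z wins = u≢w (unique (hybrid z z x z x) (free wins) (local-w (uniform w-wins)))

      v-wins-at : Wins v (hybrid p x y z x)
      -- With `x` in the class `c`, `w` sees the same as at `hybrid p x x x x`, where `u` wins. So
      -- `v` wins here, and it does not notice `c` changing to `z`.
      v-wins-at with winner (hybrid p x y x x)
      ... | i , wins with exhaustive i
      ... | inj₁ refl                      = contradiction wins u-loses-y
      ... | inj₂ (inj₁ refl)               = local-v wins
      ... | inj₂ (inj₂ (inj₁ refl))        = contradiction wins (silence v′-silent)
      ... | inj₂ (inj₂ (inj₂ (inj₁ refl))) =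
              contradiction (unique (hybrid p x x x x) u-wins-at (local-w wins)) u≢w
      ... | inj₂ (inj₂ (inj₂ (inj₂ refl))) = contradiction wins (silence w′-silent)

      w-wins-at : Wins w (hybrid p x y z x)
      w-wins-at with winner (hybrid p x x z x)
      ... | i , wins with exhaustive i
      ... | inj₁ refl                      = contradiction wins u-loses-z
      ... | inj₂ (inj₁ refl)               =
              contradiction (unique (hybrid p x x x x) u-wins-at (local-v wins)) u≢v
      ... | inj₂ (inj₂ (inj₁ refl))        = contradiction wins (silence v′-silent)
      ... | inj₂ (inj₂ (inj₂ (inj₁ refl))) = local-w wins
      ... | inj₂ (inj₂ (inj₂ (inj₂ refl))) = contradiction wins (silence w′-silent)

  -- The inputs `x₁` and `x₂` silence opposite members of the pair `v`, `v′`, and each also silences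
  -- one of `w`, `w′`. If these differ, the silences are opposite in both pairs. If they coincide,
  -- `x₃` or `x₄` silences the other one and is opposite to `x₁` or `x₂` in both pairs.
  no-bowtie : ∀ {u v v′ w w′} →
    (∀ i → i ≡ u ⊎ i ≡ v ⊎ i ≡ v′ ⊎ i ≡ w ⊎ i ≡ w′) →
    u ≢ v → u ≢ w → u ≢ w′ → v ≢ v′ → w ≢ w′ → v ≢ w → v ≢ w′ →
    Apart u v v′ → ¬ Apart u w w′
  no-bowtie {u} {v} {v′} {w} {w′}
    exhaustive u≢v u≢w u≢w′ v≢v′ w≢w′ v≢w v≢w′ apart-v apart-w
    with x₁ , v-wins ← elect v | x₂ , v′-wins ← elect v′
       | x₃ , w-wins ← elect w | x₄ , w′-wins ← elect w′ =
    w-or-w′ x₁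
      (λ w₁ → w-or-w′ x₂
        (λ w₂ → v-or-v′ x₃
          (λ v₃ → crossed v′₁ w₁ v₃ w′₃)
          (λ v′₃ → straight v′₃ w′₃ v₂ w₂))
        (λ w′₂ → crossed v′₁ w₁ v₂ w′₂))
      (λ w′₁ → w-or-w′ x₂
        (λ w₂ → straight v′₁ w′₁ v₂ w₂)
        (λ w′₂ → v-or-v′ x₄
          (λ v₄ → straight v′₁ w′₁ v₄ w₄)
          (λ v′₄ → crossed v′₄ w₄ v₂ w′₂)))
    where
    v-or-v′ : ∀ x → ¬ Silent u v x → ¬ ¬ Silent u v′ x
    v-or-v′ x = one-silent v≢v′ apart-v

    w-or-w′ : ∀ x → ¬ Silent u w x → ¬ ¬ Silent u w′ x
    w-or-w′ x = one-silent w≢w′ apart-w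

    apart-v′ : Apart u v′ v
    apart-v′ k k∈u k∈v′ k∈v = apart-v k k∈u k∈v k∈v′

    apart-w′ : Apart u w′ w
    apart-w′ k k∈u k∈w′ k∈w = apart-w k k∈u k∈w k∈w′

    v′₁ : Silent u v′ x₁
    v′₁ = silent v≢v′ apart-v v-wins

    v₂ : Silent u v x₂
    v₂ = silent (v≢v′ ∘ sym) apart-v′ v′-wins

    w′₃ : Silent u w′ x₃
    w′₃ = silent w≢w′ apart-w w-wins

    w₄ : Silent u w x₄
    w₄ = silent (w≢w′ ∘ sym) apart-w′ w′-wins

    straight : ∀ {p q} → Silent u v′ p → Silent u w′ p → Silent u v q → ¬ Silent u w q
    straight = Classes.opposite-silences exhaustive u≢v u≢w v≢w apart-v apart-w

    crossed : ∀ {p q} → Silent u v′ p → Silent u w p → Silent u v q → ¬ Silent u w′ q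
    crossed = Classes.opposite-silences
      (Sum.map₂ (Sum.map₂ (Sum.map₂ Sum.swap)) ∘ exhaustive) u≢v u≢w′ v≢w′ apart-v apart-w′

-- Combinatorics of triangles.

-- A triangle `a c d` through `b` is also a triangle at `b`. If `b` is a fourth vertex, then `b c d`
-- lies in `K b` but not in `K a`: its three vertices differ from `a`, and a triangle at `a` has
-- only two such vertices.
K-inclusion-symmetric : {a b : Fin n} → K b ⊆ᶜ K a → K a ⊆ᶜ K b
K-inclusion-symmetric {a = a} {b} Kb⊆Ka simplex nonempty
  with simplex nonempty
... | _ , (c , d , c≢a , d≢a , c≢d , refl) , S⊆ with b ≟ a | b ≟ c | b ≟ d
... | yes refl | _ | _ = _ , (c , d , c≢a , d≢a , c≢d , refl) , S⊆
... | no b≢a | yes refl | _ =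
  triangle b a d , (a , d , b≢a ∘ sym , c≢d ∘ sym , d≢a ∘ sym , refl) ,
  ∈-triangle⁺ ∘ [ inj₂ ∘ inj₁ , [ inj₁ , inj₂ ∘ inj₂ ]′ ]′ ∘ ∈-triangle⁻ ∘ S⊆
... | no b≢a | no b≢c | yes refl =
  triangle b a c , (a , c , b≢a ∘ sym , c≢d , c≢a ∘ sym , refl) ,
  ∈-triangle⁺ ∘ [ inj₂ ∘ inj₁ , [ inj₂ ∘ inj₂ , inj₁ ]′ ]′ ∘ ∈-triangle⁻ ∘ S⊆
... | no b≢a | no b≢c | no b≢d
  with Kb⊆Ka {triangle b c d} (λ _ → _ , (c , d , b≢c ∘ sym , b≢d ∘ sym , c≢d , refl) , λ x∈ → x∈)
             (b , ∈-triangle⁺ (inj₁ refl))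
... | _ , (p , q , _ , _ , _ , refl) , bcd⊆apq = contradiction
  (pigeonhole (other b≢a (inj₁ refl)) (other c≢a (inj₂ (inj₁ refl))) (other d≢a (inj₂ (inj₂ refl))))
  [ b≢c , [ b≢d , c≢d ]′ ]′
  where
  other : ∀ {x} → x ≢ a → x ≡ b ⊎ x ≡ c ⊎ x ≡ d → x ≡ p ⊎ x ≡ q
  other x≢a x∈bcd with ∈-triangle⁻ (bcd⊆apq (∈-triangle⁺ x∈bcd))
  ... | inj₁ x≡a   = contradiction x≡a x≢a
  ... | inj₂ x≡p⊎q = x≡p⊎q

allSubset? : {P : Pred (Subset n) 0ℓ} → Decidable P → Dec (∀ S → P S)
allSubset? {zero}  P? = map′ (λ { p [] → p }) (λ h → h []) (P? [])
allSubset? {suc n} P? =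
  map′ (λ { (h , k) (true ∷ S) → h S ; (h , k) (false ∷ S) → k S })
       (λ h → (λ S → h (true ∷ S)) , (λ S → h (false ∷ S)))
       (allSubset? (λ S → P? (true ∷ S)) ×-dec allSubset? (λ S → P? (false ∷ S)))

-- For sets of size 3 this forces `n` to be 5.
Bowtie : (T T′ : Subset n) → Set
Bowtie T T′ = (∀ i → i ∈ T ∪ T′) × ∣ T ∩ T′ ∣ ≡ 1

bowtie? : (T T′ : Subset n) → Dec (Bowtie T T′)
bowtie? T T′ = all? (λ i → i ∈? T ∪ T′) ×-dec (∣ T ∩ T′ ∣ ℕ.≟ 1)

-- The configuration excluded by `edge-in-triangle`, with spine `u v`. For `n` at most 5 an edge
-- lies on at most three triangles, so three missing ones can exhaust them.
Book : (T T′ T″ : Subset n) → Set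
Book T T′ T″ = ∃[ u ] ∃[ v ] (u ≢ v × (∀ w → u ≢ w → v ≢ w →
  T ⊆ triangle u v w ⊎ T′ ⊆ triangle u v w ⊎ T″ ⊆ triangle u v w))

book? : (T T′ T″ : Subset n) → Dec (Book T T′ T″)
book? T T′ T″ = any? λ u → any? λ v → ¬? (u ≟ v) ×-dec all? λ w →
  ¬? (u ≟ w) →-dec ¬? (v ≟ w) →-dec
  ((T ⊆? triangle u v w) ⊎-dec (T′ ⊆? triangle u v w) ⊎-dec (T″ ⊆? triangle u v w))

-- Missing triangles are picked one after the other, each through a vertex d or e chosen
-- in view of the previous ones, so that they cover more and more vertices.
Covering : ℕ → Set
Covering n = (T : Subset n) → ∣ T ∣ ≡ 3 →
  ∃[ d ] ((T′ : Subset n) → d ∈ T′ → ∣ T′ ∣ ≡ 3 → Bowtie T T′ ⊎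
  (∃[ e ] ((T″ : Subset n) → e ∈ T″ → ∣ T″ ∣ ≡ 3 →
    Bowtie T T″ ⊎ Bowtie T′ T″ ⊎ Book T T′ T″)))

covering? : ∀ n → Dec (Covering n)
covering? n = allSubset? λ T → (∣ T ∣ ℕ.≟ 3) →-dec
  any? λ d → allSubset? λ T′ → (d ∈? T′) →-dec (∣ T′ ∣ ℕ.≟ 3) →-dec (bowtie? T T′ ⊎-dec
  any? λ e → allSubset? λ T″ → (e ∈? T″) →-dec (∣ T″ ∣ ℕ.≟ 3) →-dec
    (bowtie? T T″ ⊎-dec bowtie? T′ T″ ⊎-dec book? T T′ T″))

-- Names for the vertices of a bowtie, in the form that `no-bowtie` takes.
Labelling : (T T′ : Subset n) → Set
Labelling {n} T T′ = ∃[ u ] ∃[ v ] ∃[ v′ ] (T ⊆ triangle u v v′ × u ≢ v × v ≢ v′ ×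
  (∃[ w ] ∃[ w′ ] (T′ ⊆ triangle u w w′ × u ≢ w × u ≢ w′ × w ≢ w′ × v ≢ w × v ≢ w′ ×
    ((i : Fin n) → i ≡ u ⊎ i ≡ v ⊎ i ≡ v′ ⊎ i ≡ w ⊎ i ≡ w′))))

labelling? : (T T′ : Subset n) → Dec (Labelling T T′)
labelling? T T′ = any? λ u → any? λ v → any? λ v′ →
  (T ⊆? triangle u v v′) ×-dec ¬? (u ≟ v) ×-dec ¬? (v ≟ v′) ×-dec
  any? λ w → any? λ w′ →
  (T′ ⊆? triangle u w w′) ×-dec ¬? (u ≟ w) ×-dec ¬? (u ≟ w′) ×-dec ¬? (w ≟ w′) ×-dec
  ¬? (v ≟ w) ×-dec ¬? (v ≟ w′) ×-dec
  all? λ i → (i ≟ u) ⊎-dec (i ≟ v) ⊎-dec (i ≟ v′) ⊎-dec (i ≟ w) ⊎-dec (i ≟ w′)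

record TriangleGeometry (n : ℕ) : Set where
  field
    size     : (a c d : Fin n) → c ≢ a → d ≢ a → c ≢ d → ∣ triangle a c d ∣ ≡ 3
    covering : Covering n
    label    : (T T′ : Subset n) → ∣ T ∣ ≡ 3 → ∣ T′ ∣ ≡ 3 → Bowtie T T′ → Labelling T T′

triangleGeometry? : ∀ n → Dec (TriangleGeometry n)
triangleGeometry? n = map′
  (λ (s , c , l) → record { size = s ; covering = c ; label = l })
  (λ g → let open TriangleGeometry g in size , covering , label)
  ((all? λ a → all? λ c → all? λ d →
      ¬? (c ≟ a) →-dec ¬? (d ≟ a) →-dec ¬? (c ≟ d) →-dec (∣ triangle a c d ∣ ℕ.≟ 3))
   ×-dec covering? n
   ×-dec (allSubset? λ T → allSubset? λ T′ → (∣ T ∣ ℕ.≟ 3) →-dec (∣ T′ ∣ ℕ.≟ 3) →-dec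
      bowtie? T T′ →-dec labelling? T T′))

-- Minimal generating complexes.

module _ (geometry : TriangleGeometry (3 + n)) where

  open TriangleGeometry geometry

  generating-contains-K : (C : Complex (3 + n)) → Generates C (U (3 + n)) → ∃[ a ] K a ⊆ᶜ C
  generating-contains-K C (_ , _ , f , image , Kf⊆C)
    with any? (λ a → all? λ c → all? λ d →
         ¬? (c ≟ a) →-dec ¬? (d ≟ a) →-dec ¬? (c ≟ d) →-dec simplex? C (triangle a c d))
  ... | yes (a , full) = a , Ka⊆C
    where
    Ka⊆C : K a ⊆ᶜ C
    Ka⊆C {S} simplex with nonempty? S
    ... | no ¬ne = closed C (λ x∈S → contradiction (_ , x∈S) ¬ne) (empty C)
    ... | yes ne with _ , (c , d , c≢a , d≢a , c≢d , refl) , S⊆ ← simplex ne =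
      closed C S⊆ (full c d c≢a d≢a c≢d)
  ... | no deficient = ⊥-elim absurd
    where
    open Election f image (𝒲 f) (λ i → proj₁ (proj₂ (inputWindow f i)))

    -- Existence of a missing triangle at `a` in continuation form: a contradiction may be derived
    -- from an arbitrary one.
    missing : ∀ a → ¬ (∀ T → a ∈ T → ∣ T ∣ ≡ 3 → ¬ ¬ Simplex C T)
    missing a h = deficient (a , λ c d c≢a d≢a c≢d →
      decidable-stable (simplex? C (triangle a c d))
        (h (triangle a c d) (∈-triangle⁺ (inj₁ refl)) (size a c d c≢a d≢a c≢d)))

    -- A common input of the three would make `T` a simplex of the communication complex, hence of
    -- `C`.
    apart : ∀ {T u v w} → ¬ Simplex C T → T ⊆ triangle u v w → Apart u v w
    apart {T} {u} {v} {w} T∉C T⊆ k k∈u k∈v k∈w =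
      T∉C (Kf⊆C λ _ → k , λ i i∈T → read (∈-triangle⁻ (T⊆ i∈T)))
      where
      read : ∀ {i} → i ≡ u ⊎ i ≡ v ⊎ i ≡ w → k ∈ 𝒲 f i
      read (inj₁ refl)        = k∈u
      read (inj₂ (inj₁ refl)) = k∈v
      read (inj₂ (inj₂ refl)) = k∈w

    not-bowtie : ∀ {T T′} → ∣ T ∣ ≡ 3 → ∣ T′ ∣ ≡ 3 → ¬ Simplex C T → ¬ Simplex C T′ →
                  ¬ Bowtie T T′
    not-bowtie {T} {T′} s s′ T∉C T′∉C bow
      with u , v , v′ , T⊆ , u≢v , v≢v′ ,
           w , w′ , T′⊆ , u≢w , u≢w′ , w≢w′ , v≢w , v≢w′ , exhaustive ← label T T′ s s′ bow =
      no-bowtie exhaustive u≢v u≢w u≢w′ v≢v′ w≢w′ v≢w v≢w′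
        (apart T∉C T⊆) (apart T′∉C T′⊆)

    no-book : ∀ {T T′ T″} → ¬ Simplex C T → ¬ Simplex C T′ → ¬ Simplex C T″ → ¬ Book T T′ T″
    no-book T∉C T′∉C T″∉C (u , v , u≢v , pages) =
      let (_ , u≢t , v≢t) = third u v in
      edge-in-triangle u≢v u≢t v≢t λ w u≢w v≢w →
        [ apart T∉C , [ apart T′∉C , apart T″∉C ]′ ]′ (pages w u≢w v≢w)

    absurd : ⊥
    absurd =
      missing zero λ T _ s T∉C → let (d , next) = covering T s in
      missing d λ T′ d∈T′ s′ T′∉C →
        [ not-bowtie s s′ T∉C T′∉C
        , (λ (e , last) → missing e λ T″ e∈T″ s″ T″∉C →
            [ not-bowtie s s″ T∉C T″∉C
            , [ not-bowtie s′ s″ T′∉C T″∉C , no-book T∉C T′∉C T″∉C ]′ ]′ (last T″ e∈T″ s″))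
        ]′ (next T′ d∈T′ s′)

  minimal⇔K : (C : Complex (3 + n)) → IsMinimalGenerating C (U (3 + n)) ⇔ (∃[ a ] C ≐ᶜ K a)
  minimal⇔K C = mk⇔ minimal-is-K K-is-minimal
    where
    K-generates : ∀ a → Generates (K a) (U (3 + n))
    K-generates a = Duels.K-generates a (third a)

    minimal-is-K : IsMinimalGenerating C (U (3 + n)) → ∃[ a ] C ≐ᶜ K a
    minimal-is-K (generates , minimal) with a , Ka⊆C ← generating-contains-K C generates =
      -- A simplex of `C` outside `K a` would make `K a` a strictly smaller generating complex.
      a , (λ {S} S∈C → decidable-stable (simplex? (K a) S) λ S∉Ka →
        minimal (K a) (Ka⊆C , λ C⊆Ka → S∉Ka (C⊆Ka S∈C)) (K-generates a)) , Ka⊆C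

    K-is-minimal : ∃[ a ] C ≐ᶜ K a → IsMinimalGenerating C (U (3 + n))
    K-is-minimal (a , C⊆Ka , Ka⊆C) =
      (let (b , m , f , image , Kf⊆Ka) = K-generates a in
        b , m , f , image , λ s → Ka⊆C (Kf⊆Ka s)) ,
      -- From `K b ⊆ C′ ⊆ C ⊆ K a` the symmetry of inclusion gives `C ⊆ K a ⊆ K b ⊆ C′`.
      λ C′ (C′⊆C , C⊈C′) generates →
        let (b , Kb⊆C′) = generating-contains-K C′ generates
            Ka⊆Kb       = K-inclusion-symmetric {a = a} {b} λ s → C⊆Ka (C′⊆C (Kb⊆C′ s))
        in C⊈C′ λ S∈C → Kb⊆C′ (Ka⊆Kb (C⊆Ka S∈C))

geometry-of-3 : TriangleGeometry 3
geometry-of-3 = toWitness {a? = triangleGeometry? 3} tt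

geometry-of-4 : TriangleGeometry 4
geometry-of-4 = toWitness {a? = triangleGeometry? 4} tt

-- For `covering`, take `d` outside `T`. Then `T′` meets `T` in one vertex, a bowtie, or in an edge.
-- In the latter case take for `e` the fifth vertex: `T″` contains the common edge, giving a book,
-- or forms a bowtie with `T` or `T′`.
geometry-of-5 : TriangleGeometry 5
geometry-of-5 = toWitness {a? = triangleGeometry? 5} tt

proposition4p3 : (n : ℕ) → 3 ≤ n → n ≤ 5 →
    (C : Complex n) → IsMinimalGenerating C (U n) ⇔ (∃[ a ] C ≐ᶜ K a)
proposition4p3 3 _ _ = minimal⇔K geometry-of-3
proposition4p3 4 _ _ = minimal⇔K geometry-of-4
proposition4p3 5 _ _ = minimal⇔K geometry-of-5
proposition4p3 1 (s≤s ())
proposition4p3 2 (s≤s (s≤s ()))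
proposition4p3 (suc (suc (suc (suc (suc (suc _)))))) _ (s≤s (s≤s (s≤s (s≤s (s≤s ())))))
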